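{- Let $1\le k\le n$, $t\ge0$, $q_2\in[0,1]$. Start a deck of $n$ distinct cards in the order $1,2,\dots,n$ from top to bottom. After $t$ top-to-random shuffles (resp. $t$ binomial-top-to-random shuffles with parameter $q_2$), the distribution on $\mathfrak S_k$ of the standardisation of the values of the bottommost $k$ cards (read top to bottom) equals the distribution of a deck of $k$ cards, started in order $1,\dots,k$, after $t$ steps of the $\frac{n-k}{n}$-lazy version of the top-to-random shuffle (resp. after $t$ binomial-top-to-random shuffles with the same parameter $q_2$).
   Context: A deck is recorded as the sequence $w_1\cdots w_n$ of card values from top to bottom. Top-to-random shuffle: remove the top card and reinsert it at one of the $n$ positions chosen uniformly. Binomial-top-to-random shuffle with parameter $q_2$: choose $r\sim\mathrm{Binomial}(n,1-q_2)$, remove the top $r$ cards and reinsert them so that the resulting deck is uniform among the $n!/(n-r)!$ arrangements in which the other $n-r$ cards keep their relative order. Standardisation of a string of distinct numbers replaces its letters by $1,2,\dots$ preserving relative order. The $\alpha$-lazy version of a chain with transition matrix $K$ has transition matrix $\alpha\,\mathrm{id}+(1-\alpha)K$.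
   Formalization: The parameter q₂ of the binomial-top-to-random shuffle ranges over the rational numbers in [0,1] instead of all real numbers in [0,1]. -}

module Defs where

open import Data.Nat as ℕ using (ℕ; zero; suc; _∸_; _<ᵇ_)
open import Data.Nat.Combinatorics using (_C_)
open import Data.Integer using (+_)
open import Data.Rational using (ℚ; 0ℚ; 1ℚ; _+_; _*_; _-_; _/_)
open import Data.List using (List; []; _∷_; length; map; concatMap; upTo; drop; splitAt; _++_; foldr)
open import Data.List.Properties using (≡-dec)
open import Data.Product using (_×_; _,_; proj₁; proj₂)
open import Data.Bool using (if_then_else_)
open import Relation.Nullary using (does)
open import Relation.Binary.PropositionalEquality using (_≡_)
import Data.Nat.Properties as ℕP

-- A deck: card values from top to bottom.
Deck : Set
Deck = List ℕ

-- A finitely supported (signed-measure-like) distribution: a formal sum of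
-- weighted decks.  Two distributions are equal when every deck gets the same
-- total mass.
Dist : Set
Dist = List (Deck × ℚ)

mass : Deck → Dist → ℚ
mass w [] = 0ℚ
mass w ((v , p) ∷ d) =
  (if does (≡-dec ℕP._≟_ w v) then p else 0ℚ) + mass w d

_≈ᴰ_ : Dist → Dist → Set
d₁ ≈ᴰ d₂ = (w : Deck) → mass w d₁ ≡ mass w d₂

-- a / d as a rational (0 if d = 0; never used with d = 0 in the theorem)
frac : ℕ → ℕ → ℚ
frac a zero = 0ℚ
frac a (suc d) = (+ a) / suc d

powℚ : ℚ → ℕ → ℚ
powℚ q zero = 1ℚ
powℚ q (suc m) = q * powℚ q m

Kernel : Set
Kernel = Deck → Dist

step : Kernel → Dist → Dist
step K = concatMap (λ { (v , p) → map (λ { (u , r) → (u , p * r) }) (K v) })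

iterate : Kernel → ℕ → Dist → Dist
iterate K zero d = d
iterate K (suc t) d = step K (iterate K t d)

uniform : List Deck → Dist
uniform ds = map (λ u → (u , frac 1 (length ds))) ds

insertAt : ℕ → ℕ → Deck → Deck
insertAt zero x w = x ∷ w
insertAt (suc i) x [] = x ∷ []
insertAt (suc i) x (y ∷ w) = y ∷ insertAt i x w

insertions : ℕ → Deck → List Deck
insertions x w = map (λ i → insertAt i x w) (upTo (suc (length w)))

topToRandom : Kernel
topToRandom [] = ([] , 1ℚ) ∷ []
topToRandom (x ∷ w) = uniform (insertions x w)

-- All arrangements of the cards of a together with b in which the cards of b
-- keep their relative order (obtained by inserting the cards of a one at a
-- time at arbitrary positions; for distinct cards each arrangement is listed
-- exactly once, giving n!/(n-r)! arrangements).
arrangements : Deck → Deck → List Deck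
arrangements [] b = b ∷ []
arrangements (x ∷ a) b = concatMap (insertions x) (arrangements a b)

-- Binomial-top-to-random with parameter q₂: r ~ Binomial(n, 1 - q₂),
-- remove the top r cards and reinsert them uniformly among the arrangements
-- in which the other n - r cards keep their relative order.
binomialTopToRandom : ℚ → Kernel
binomialTopToRandom q w =
  concatMap
    (λ r → let n = length w
               ab = splitAt r w
               pr = (+ (n C r) / 1) * powℚ (1ℚ - q) r * powℚ q (n ∸ r)
           in map (λ { (u , s) → (u , pr * s) })
                  (uniform (arrangements (proj₁ ab) (proj₂ ab))))
    (upTo (suc (length w)))

lazy : ℚ → Kernel → Kernel
lazy α K w = (w , α) ∷ map (λ { (u , r) → (u , (1ℚ - α) * r) }) (K w)

push : (Deck → Deck) → Dist → Dist
push f = map (λ { (v , p) → (f v , p) })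

standardise : Deck → Deck
standardise w = map (λ x → suc (foldr (λ y c → if y <ᵇ x then suc c else c) 0 w)) w

bottom : ℕ → ℕ → Deck → Deck
bottom n k w = drop (n ∸ k) w

start : ℕ → Dist
start n = (map suc (upTo n) , 1ℚ) ∷ []

{-# OPTIONS --safe #-}
module Submission where

-- Let R r f w be the sum of f over the arrangements of the top r cards of w among the others,
-- and let g r = R r f (1 … n).  Replacing f by its sum over the reinsertions of the top card
-- turns g into 𝕏 g, where (𝕏 g) r = r g r + g (r + 1), whatever n is; summing f over the
-- reinsertions of the top s cards turns g into the falling factorial 𝕏 (𝕏 - 1) ⋯ (𝕏 - s + 1) g.
-- Replacing f by f ∘ standardise ∘ tail, one card more in the deck, turns g into ℙ g, where
-- (ℙ g) r = r g (r - 1) + g r, because the top card is either one of the r moved cards or the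
-- first of the others, and an arrangement of the remaining cards is left in each case.
-- The commutation 𝕏 ℙ = ℙ (𝕏 + 1) is what produces the laziness in the first case, and through
-- Pascal's rule for falling factorials the invariance of q₂ in the second.

open import Defs
open import Data.Bool using (true; false; if_then_else_)
open import Data.Empty using (⊥-elim)
open import Data.Fin as Fin using (Fin; toℕ)
import Data.Integer as ℤ
import Data.Integer.Properties as ℤP
open import Data.List using (List; []; _∷_; _++_; map; length; concatMap; take; drop; splitAt; removeAt; foldr; upTo; applyUpTo)
open import Data.List.Properties using (≡-dec; map-∘; map-cong; map-id; map-cong-local; map-applyUpTo; map-upTo; length-map; length-applyUpTo; length-take; splitAt-defn; take++drop≡id; drop-map)
import Data.List.Relation.Binary.Permutation.Propositional as Perm
open Perm using (_↭_; ↭-refl; ↭-sym; ↭-trans; prep; swap)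
open import Data.List.Relation.Binary.Permutation.Propositional.Properties using (All-resp-↭; ↭-length)
open import Data.List.Relation.Unary.All.Properties using (applyUpTo⁺₁)
open import Data.Nat as ℕ using (ℕ; zero; suc; _≤_; _∸_; _!)
open import Data.Nat.Combinatorics using (_C_; nCk≡n!/k![n-k]!; k![n∸k]!∣n!)
open import Data.Nat.DivMod using (m/n*n≡m)
import Data.Nat.Properties as ℕP
open import Data.Product using (_×_; _,_; proj₁; proj₂)
open import Data.Rational using (ℚ; 0ℚ; 1ℚ; _+_; _*_; _-_; -_; _/_; toℚᵘ; fromℚᵘ) renaming (_≤_ to _≤ℚ_)
open import Data.Rational.Properties using (+-comm; +-assoc; +-identityˡ; +-identityʳ; *-assoc; *-identityˡ; *-identityʳ; *-zeroˡ; *-zeroʳ; *-distribˡ-+; toℚᵘ-injective; toℚᵘ-fromℚᵘ; toℚᵘ-homo-+; toℚᵘ-homo-*; fromℚᵘ-cong)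
open import Data.Rational.Solver using (module +-*-Solver)
open import Data.Rational.Unnormalised as ℚᵘ using (mkℚᵘ; *≡*)
import Data.Rational.Unnormalised.Properties as ℚᵘP
open import Data.Sum using (_⊎_; inj₁; inj₂)
open import Relation.Binary.PropositionalEquality using (_≡_; refl; sym; trans; cong; cong₂; subst; module ≡-Reasoning)
open import Relation.Nullary using (does)
open +-*-Solver using (solve; con; _:=_; _:+_; _:*_; _:-_; :-_)

-- Arithmetic of naturals and unit fractions in ℚ.

fromℚᵘ-homo-+ : ∀ x y → fromℚᵘ (x ℚᵘ.+ y) ≡ fromℚᵘ x + fromℚᵘ y
fromℚᵘ-homo-+ x y = toℚᵘ-injective (begin
  toℚᵘ (fromℚᵘ (x ℚᵘ.+ y))              ≈⟨ toℚᵘ-fromℚᵘ (x ℚᵘ.+ y) ⟩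
  x ℚᵘ.+ y                              ≈⟨ ℚᵘP.+-cong (toℚᵘ-fromℚᵘ x) (toℚᵘ-fromℚᵘ y) ⟨
  toℚᵘ (fromℚᵘ x) ℚᵘ.+ toℚᵘ (fromℚᵘ y)  ≈⟨ toℚᵘ-homo-+ (fromℚᵘ x) (fromℚᵘ y) ⟨
  toℚᵘ (fromℚᵘ x + fromℚᵘ y)            ∎)
  where open ℚᵘP.≃-Reasoning

fromℚᵘ-homo-* : ∀ x y → fromℚᵘ (x ℚᵘ.* y) ≡ fromℚᵘ x * fromℚᵘ y
fromℚᵘ-homo-* x y = toℚᵘ-injective (begin
  toℚᵘ (fromℚᵘ (x ℚᵘ.* y))              ≈⟨ toℚᵘ-fromℚᵘ (x ℚᵘ.* y) ⟩
  x ℚᵘ.* y                              ≈⟨ ℚᵘP.*-cong (toℚᵘ-fromℚᵘ x) (toℚᵘ-fromℚᵘ y) ⟨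
  toℚᵘ (fromℚᵘ x) ℚᵘ.* toℚᵘ (fromℚᵘ y)  ≈⟨ toℚᵘ-homo-* (fromℚᵘ x) (fromℚᵘ y) ⟨
  toℚᵘ (fromℚᵘ x * fromℚᵘ y)            ∎)
  where open ℚᵘP.≃-Reasoning

ι : ℕ → ℚ
ι n = ℤ.+ n / 1

ι-+ : ∀ m n → ι (m ℕ.+ n) ≡ ι m + ι n
ι-+ m n = trans
  (cong (_/ 1) (trans (ℤP.pos-+ m n) (sym (cong₂ ℤ._+_ (ℤP.*-identityʳ (ℤ.+ m)) (ℤP.*-identityʳ (ℤ.+ n))))))
  (fromℚᵘ-homo-+ (mkℚᵘ (ℤ.+ m) 0) (mkℚᵘ (ℤ.+ n) 0))

ι-suc : ∀ n → ι (suc n) ≡ 1ℚ + ι n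
ι-suc n = ι-+ 1 n

ι-* : ∀ m n → ι (m ℕ.* n) ≡ ι m * ι n
ι-* m n = trans (cong (_/ 1) (ℤP.pos-* m n))
  (fromℚᵘ-homo-* (mkℚᵘ (ℤ.+ m) 0) (mkℚᵘ (ℤ.+ n) 0))

frac≡ι*frac : ∀ a n → frac a n ≡ ι a * frac 1 n
frac≡ι*frac a zero = sym (*-zeroʳ (ι a))
frac≡ι*frac a (suc d) = trans
  (fromℚᵘ-cong {mkℚᵘ (ℤ.+ a) d} {mkℚᵘ (ℤ.+ a) 0 ℚᵘ.* mkℚᵘ (ℤ.+ 1) d}
    (*≡* (cong₂ ℤ._*_ (sym (ℤP.*-identityʳ (ℤ.+ a))) (cong (λ m → ℤ.+ suc m) (ℕP.+-identityʳ d)))))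
  (fromℚᵘ-homo-* (mkℚᵘ (ℤ.+ a) 0) (mkℚᵘ (ℤ.+ 1) d))

frac-inverse : ∀ n → 1 ℕ.≤ n → frac 1 n * ι n ≡ 1ℚ
frac-inverse (suc d) _ = trans
  (sym (fromℚᵘ-homo-* (mkℚᵘ (ℤ.+ 1) d) (mkℚᵘ (ℤ.+ suc d) 0)))
  (fromℚᵘ-cong {mkℚᵘ (ℤ.+ 1) d ℚᵘ.* mkℚᵘ (ℤ.+ suc d) 0} {mkℚᵘ (ℤ.+ 1) 0}
    (*≡* (cong (λ m → ℤ.+ suc m)
      (trans (cong (ℕ._* 1) (ℕP.+-identityʳ d)) (sym (ℕP.+-identityʳ (d ℕ.* 1)))))))


-- Sums over reinsertions of removed cards.

Sequence : Set
Sequence = ℕ → ℚ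

sumOver : {A : Set} → (A → ℚ) → List A → ℚ
sumOver f []       = 0ℚ
sumOver f (x ∷ xs) = f x + sumOver f xs

insertSum : ℕ → (Deck → ℚ) → Deck → ℚ
insertSum x f []      = f (x ∷ [])
insertSum x f (y ∷ w) = f (x ∷ y ∷ w) + insertSum x (λ v → f (y ∷ v)) w

-- The sum of f over arrangements (take r w) (drop r w), but 0 when w has fewer than r cards.
removeInsertSum : ℕ → (Deck → ℚ) → Deck → ℚ
removeInsertSum zero    f w       = f w
removeInsertSum (suc r) f []      = 0ℚ
removeInsertSum (suc r) f (x ∷ w) = removeInsertSum r (insertSum x f) w

-- Agreement is asked only on rearrangements of the deck, since later uses rely on its length or on
-- its set of cards.
insertSum-cong : ∀ x {f g} w → (∀ v → v ↭ x ∷ w → f v ≡ g v) →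
                 insertSum x f w ≡ insertSum x g w
insertSum-cong x []      eq = eq _ ↭-refl
insertSum-cong x (y ∷ w) eq = cong₂ _+_ (eq _ ↭-refl)
  (insertSum-cong x w λ v v↭ → eq (y ∷ v) (↭-trans (prep y v↭) (swap y x ↭-refl)))

insertSum-+ : ∀ x f g w →
  insertSum x (λ v → f v + g v) w ≡ insertSum x f w + insertSum x g w
insertSum-+ x f g []      = refl
insertSum-+ x f g (y ∷ w) = trans
  (cong (f (x ∷ y ∷ w) + g (x ∷ y ∷ w) +_) (insertSum-+ x (λ v → f (y ∷ v)) (λ v → g (y ∷ v)) w))
  (solve 4 (λ a b c d → (a :+ b) :+ (c :+ d) := (a :+ c) :+ (b :+ d)) refl
    (f (x ∷ y ∷ w)) (g (x ∷ y ∷ w)) _ _)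

insertSum-* : ∀ c x f w → insertSum x (λ v → c * f v) w ≡ c * insertSum x f w
insertSum-* c x f []      = refl
insertSum-* c x f (y ∷ w) = trans
  (cong (c * f (x ∷ y ∷ w) +_) (insertSum-* c x (λ v → f (y ∷ v)) w))
  (sym (*-distribˡ-+ c (f (x ∷ y ∷ w)) _))

-- Both orders of insertion run through all placements of x and y in the deck; the induction splits
-- them by which of x and y land above z.
insertSum-comm : ∀ x y f w → insertSum x (insertSum y f) w ≡ insertSum y (insertSum x f) w
insertSum-comm x y f [] = +-comm (f (y ∷ x ∷ [])) (f (x ∷ y ∷ []))
insertSum-comm x y f (z ∷ w) = begin
  (a + (b + c)) + insertSum x (λ v → f (y ∷ z ∷ v) + insertSum y fz v) w
    ≡⟨ cong ((a + (b + c)) +_) (insertSum-+ x (λ v → f (y ∷ z ∷ v)) (insertSum y fz) w) ⟩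
  (a + (b + c)) + (d + insertSum x (insertSum y fz) w)
    ≡⟨ cong (λ e → (a + (b + c)) + (d + e)) (insertSum-comm x y fz w) ⟩
  (a + (b + c)) + (d + insertSum y (insertSum x fz) w)
    ≡⟨ solve 5 (λ a b c d e → (a :+ (b :+ c)) :+ (d :+ e) := (b :+ (a :+ d)) :+ (c :+ e))
         refl a b c d _ ⟩
  (b + (a + d)) + (c + insertSum y (insertSum x fz) w)
    ≡⟨ cong ((b + (a + d)) +_) (insertSum-+ y (λ v → f (x ∷ z ∷ v)) (insertSum x fz) w) ⟨
  (b + (a + d)) + insertSum y (λ v → f (x ∷ z ∷ v) + insertSum x fz v) w ∎
  where
  open ≡-Reasoning
  fz = λ v → f (z ∷ v)
  a = f (y ∷ x ∷ z ∷ w)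
  b = f (x ∷ y ∷ z ∷ w)
  c = insertSum y (λ v → f (x ∷ z ∷ v)) w
  d = insertSum x (λ v → f (y ∷ z ∷ v)) w

insertSum-map : ∀ φ x f w → insertSum (φ x) f (map φ w) ≡ insertSum x (λ v → f (map φ v)) w
insertSum-map φ x f []      = refl
insertSum-map φ x f (y ∷ w) = cong (f (φ x ∷ φ y ∷ map φ w) +_) (insertSum-map φ x (λ v → f (φ y ∷ v)) w)

removeInsertSum-cong : ∀ r {f g} w → (∀ v → v ↭ w → f v ≡ g v) →
                       removeInsertSum r f w ≡ removeInsertSum r g w
removeInsertSum-cong zero    w       eq = eq w ↭-refl
removeInsertSum-cong (suc r) []      eq = refl
removeInsertSum-cong (suc r) (x ∷ w) eq = removeInsertSum-cong r w λ v v↭w →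
  insertSum-cong x v λ u u↭ → eq u (↭-trans u↭ (prep x v↭w))

removeInsertSum-+ : ∀ r f g w → removeInsertSum r (λ v → f v + g v) w
                                ≡ removeInsertSum r f w + removeInsertSum r g w
removeInsertSum-+ zero    f g w       = refl
removeInsertSum-+ (suc r) f g []      = refl
removeInsertSum-+ (suc r) f g (x ∷ w) = trans
  (removeInsertSum-cong r w λ v _ → insertSum-+ x f g v)
  (removeInsertSum-+ r (insertSum x f) (insertSum x g) w)

removeInsertSum-* : ∀ c r f w →
  removeInsertSum r (λ v → c * f v) w ≡ c * removeInsertSum r f w
removeInsertSum-* c zero    f w       = refl
removeInsertSum-* c (suc r) f []      = sym (*-zeroʳ c)
removeInsertSum-* c (suc r) f (x ∷ w) = trans
  (removeInsertSum-cong r w λ v _ → insertSum-* c x f v)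
  (removeInsertSum-* c r (insertSum x f) w)

removeInsertSum-map : ∀ φ r f w →
  removeInsertSum r f (map φ w) ≡ removeInsertSum r (λ v → f (map φ v)) w
removeInsertSum-map φ zero    f w       = refl
removeInsertSum-map φ (suc r) f []      = refl
removeInsertSum-map φ (suc r) f (x ∷ w) = trans
  (removeInsertSum-map φ r (insertSum (φ x) f) w)
  (removeInsertSum-cong r w λ v _ → insertSum-map φ x f v)

removeInsertSum-vanishes : ∀ r f w → length w ℕ.< r → removeInsertSum r f w ≡ 0ℚ
removeInsertSum-vanishes (suc r) f []      _            = refl
removeInsertSum-vanishes (suc r) f (x ∷ w) (ℕ.s≤s w<r) =
  removeInsertSum-vanishes r (insertSum x f) w w<r

topSum : (Deck → ℚ) → Deck → ℚ
topSum = removeInsertSum 1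

-- The card on top is either x, whose second insertion overrides the first, or the old top card y,
-- whose reinsertion commutes with that of x.
insertSum-topSum : ∀ x f w →
  insertSum x (topSum f) w ≡ insertSum x f w + topSum (insertSum x f) w
insertSum-topSum x f []      = sym (+-identityʳ _)
insertSum-topSum x f (y ∷ w) = begin
  insertSum x f (y ∷ w) + insertSum x (insertSum y f) w
    ≡⟨ cong (insertSum x f (y ∷ w) +_) (insertSum-comm x y f w) ⟩
  insertSum x f (y ∷ w) + insertSum y (insertSum x f) w ∎
  where open ≡-Reasoning

-- Read g j as a linear functional evaluated at the falling factorial x(x - 1)⋯(x - j + 1). Then 𝕏
-- precomposes the functional with multiplication by x.
𝕏 : Sequence → Sequence
𝕏 g j = ι j * g j + g (suc j)

-- Each of the r moved cards, when it is on top, contributes one copy of the same sum; when none of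
-- them is, the next card is taken and r + 1 cards have moved.
removeInsertSum-topSum : ∀ r f w →
  removeInsertSum r (topSum f) w ≡ 𝕏 (λ s → removeInsertSum s f w) r
removeInsertSum-topSum zero f w =
  solve 2 (λ a b → b := con 0ℚ :* a :+ b) refl (f w) (topSum f w)
removeInsertSum-topSum (suc r) f [] =
  solve 1 (λ a → con 0ℚ := a :* con 0ℚ :+ con 0ℚ) refl (ι (suc r))
removeInsertSum-topSum (suc r) f (x ∷ w) = begin
  removeInsertSum r (insertSum x (topSum f)) w
    ≡⟨ removeInsertSum-cong r w (λ v _ → insertSum-topSum x f v) ⟩
  removeInsertSum r (λ v → fx v + topSum fx v) w
    ≡⟨ removeInsertSum-+ r fx (topSum fx) w ⟩
  removeInsertSum r fx w + removeInsertSum r (topSum fx) w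
    ≡⟨ cong (removeInsertSum r fx w +_) (removeInsertSum-topSum r fx w) ⟩
  removeInsertSum r fx w + (ι r * removeInsertSum r fx w + removeInsertSum (suc r) fx w)
    ≡⟨ solve 3 (λ i a b → a :+ (i :* a :+ b) := (con 1ℚ :+ i) :* a :+ b) refl
         (ι r) (removeInsertSum r fx w) (removeInsertSum (suc r) fx w) ⟩
  (1ℚ + ι r) * removeInsertSum r fx w + removeInsertSum (suc r) fx w
    ≡⟨ cong (λ i → i * removeInsertSum r fx w + removeInsertSum (suc r) fx w) (ι-suc r) ⟨
  ι (suc r) * removeInsertSum r fx w + removeInsertSum (suc r) fx w ∎
  where
  open ≡-Reasoning
  fx = insertSum x f

-- The junk value 0ℚ makes insertSum-onTail hold for the empty deck too.
onTail : (Deck → ℚ) → Deck → ℚ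
onTail f []      = 0ℚ
onTail f (x ∷ w) = f w

insertSum-onTail : ∀ x f w →
  insertSum x (onTail f) w ≡ f w + onTail (insertSum x f) w
insertSum-onTail x f []      = sym (+-identityʳ (f []))
insertSum-onTail x f (y ∷ w) = refl

-- For the same functional, ℙ precomposes with the substitution of x + 1 for x. At j = 0 the value
-- of `ℕ.pred` is harmless because its coefficient is 0.
ℙ : Sequence → Sequence
ℙ g j = ι j * g (ℕ.pred j) + g j

-- Peeling off x turns the hypothesis for γ into one for the shifted sequence, so γ is arbitrary:
-- all that matters is that every single deletion leaves the same sums.
removeInsertSum-onTail : ∀ r f x w (γ : Sequence) →
  (∀ s (i : Fin (suc (length w))) → removeInsertSum s f (removeAt (x ∷ w) i) ≡ γ s) →
  removeInsertSum r (onTail f) (x ∷ w) ≡ ℙ γ r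
removeInsertSum-onTail zero f x w γ deletion = begin
  f w                ≡⟨ deletion 0 Fin.zero ⟩
  γ 0                ≡⟨ solve 1 (λ c → c := con 0ℚ :* c :+ c) refl (γ 0) ⟩
  0ℚ * γ 0 + γ 0     ∎
  where open ≡-Reasoning
removeInsertSum-onTail (suc r) f x w γ deletion = begin
  removeInsertSum r (insertSum x (onTail f)) w
    ≡⟨ removeInsertSum-cong r w (λ v _ → insertSum-onTail x f v) ⟩
  removeInsertSum r (λ v → f v + onTail fx v) w
    ≡⟨ removeInsertSum-+ r f (onTail fx) w ⟩
  removeInsertSum r f w + removeInsertSum r (onTail fx) w
    -- Either x lands on top and is deleted, or it stays among the moved cards and another card is
    -- deleted.
    ≡⟨ cong₂ _+_ (deletion r Fin.zero) (remaining w deletion) ⟩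
  γ r + (ι r * γ r + γ (suc r))
    ≡⟨ solve 3 (λ i a b → a :+ (i :* a :+ b) := (con 1ℚ :+ i) :* a :+ b) refl (ι r) (γ r) (γ (suc r)) ⟩
  (1ℚ + ι r) * γ r + γ (suc r)
    ≡⟨ cong (λ i → i * γ r + γ (suc r)) (ι-suc r) ⟨
  ι (suc r) * γ r + γ (suc r) ∎
  where
  open ≡-Reasoning
  fx = insertSum x f

  -- The recursive call evaluates γ at `suc (ℕ.pred r)`, which differs from r only at r = 0, where
  -- the coefficient vanishes.
  zero-or-suc : ∀ r → ι r * γ (suc (ℕ.pred r)) + γ (suc r) ≡ ι r * γ r + γ (suc r)
  zero-or-suc zero    = solve 3 (λ a b c → con 0ℚ :* a :+ c := con 0ℚ :* b :+ c) refl (γ 1) (γ 0) (γ 1)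
  zero-or-suc (suc r) = refl

  -- When x is the only card, its deletion leaves the empty deck, so γ vanishes at all positive
  -- indices.
  empty : ∀ r → removeInsertSum r f [] ≡ γ r → γ (suc r) ≡ 0ℚ →
          removeInsertSum r (onTail fx) [] ≡ ι r * γ r + γ (suc r)
  empty zero    _ γ₁≡0 rewrite γ₁≡0 = solve 1 (λ a → con 0ℚ := con 0ℚ :* a :+ con 0ℚ) refl (γ 0)
  empty (suc r) 0≡γ γ≡0 rewrite γ≡0 | sym 0≡γ =
    solve 1 (λ i → con 0ℚ := i :* con 0ℚ :+ con 0ℚ) refl (ι (suc r))

  remaining : ∀ w → (∀ s (i : Fin (suc (length w))) →
                     removeInsertSum s f (removeAt (x ∷ w) i) ≡ γ s) →
              removeInsertSum r (onTail fx) w ≡ ι r * γ r + γ (suc r)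
  remaining []      deletion = empty r (deletion r Fin.zero) (sym (deletion (suc r) Fin.zero))
  remaining (y ∷ w) deletion = trans
    (removeInsertSum-onTail r fx y w (λ s → γ (suc s)) λ s i → deletion (suc s) (Fin.suc i))
    (zero-or-suc r)

-- Relabelling after a deletion, and standardisation.

deck : ℕ → Deck
deck = applyUpTo suc

-- The increasing injection whose image misses exactly i (a coface map).
skip : ℕ → ℕ → ℕ
skip zero    x       = suc x
skip (suc i) zero    = zero
skip (suc i) (suc x) = suc (skip i x)

skip-<ᵇ : ∀ i x y → (skip i x ℕ.<ᵇ skip i y) ≡ (x ℕ.<ᵇ y)
skip-<ᵇ zero    x       y       = refl
skip-<ᵇ (suc i) zero    zero    = refl
skip-<ᵇ (suc i) zero    (suc y) = refl
skip-<ᵇ (suc i) (suc x) zero    = refl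
skip-<ᵇ (suc i) (suc x) (suc y) = skip-<ᵇ i x y

removeAt-applyUpTo : ∀ (f : ℕ → ℕ) n i →
  removeAt (applyUpTo f (suc n)) i ≡ applyUpTo (λ x → f (skip (toℕ i) x)) n
removeAt-applyUpTo f n       Fin.zero    = refl
removeAt-applyUpTo f (suc n) (Fin.suc i) = cong (f 0 ∷_) (removeAt-applyUpTo (λ x → f (suc x)) n i)

-- The maps `skip` suffice: the initial deck with one card deleted is a `skip`-relabelling of the
-- shorter initial deck.
Order-invariant : (Deck → ℚ) → Set
Order-invariant f = ∀ i w → f (map (skip i) w) ≡ f w

onTail-deck : ∀ f → Order-invariant f → ∀ n r →
  removeInsertSum r (onTail f) (deck (suc n)) ≡ ℙ (λ s → removeInsertSum s f (deck n)) r
onTail-deck f invariant n r =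
  removeInsertSum-onTail r f 1 (applyUpTo (λ x → suc (suc x)) n) _ λ s i → begin
    removeInsertSum s f (removeAt (deck (suc n)) i)
      ≡⟨ cong (removeInsertSum s f) (removeAt-applyUpTo suc n i) ⟩
    removeInsertSum s f (applyUpTo (λ x → suc (skip (toℕ i) x)) n)
      -- Values start at 1, so the card at position i has value i + 1 and that is the value to miss.
      ≡⟨ cong (removeInsertSum s f) (map-applyUpTo suc (skip (suc (toℕ i))) n) ⟨
    removeInsertSum s f (map (skip (suc (toℕ i))) (deck n))
      ≡⟨ removeInsertSum-map (skip (suc (toℕ i))) s f (deck n) ⟩
    removeInsertSum s (λ v → f (map (skip (suc (toℕ i))) v)) (deck n)
      ≡⟨ removeInsertSum-cong s (deck n) (λ v _ → invariant (suc (toℕ i)) v) ⟩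
    removeInsertSum s f (deck n) ∎
  where open ≡-Reasoning

-- The inner fold of `standardise`, which is then `map (λ x → suc (rank w x)) w` by definition.
rank : Deck → ℕ → ℕ
rank w x = foldr (λ y c → if y ℕ.<ᵇ x then suc c else c) 0 w

rank-↭ : ∀ {v w} → v ↭ w → ∀ x → rank v x ≡ rank w x
rank-↭ Perm.refl x = refl
rank-↭ (Perm.prep y p) x with y ℕ.<ᵇ x
... | true  = cong suc (rank-↭ p x)
... | false = rank-↭ p x
rank-↭ (Perm.swap y z p) x with y ℕ.<ᵇ x | z ℕ.<ᵇ x
... | true  | true  = cong (λ c → suc (suc c)) (rank-↭ p x)
... | true  | false = cong suc (rank-↭ p x)
... | false | true  = cong suc (rank-↭ p x)
... | false | false = rank-↭ p x
rank-↭ (Perm.trans p q) x = trans (rank-↭ p x) (rank-↭ q x)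

rank-map : ∀ φ → (∀ x y → (φ x ℕ.<ᵇ φ y) ≡ (x ℕ.<ᵇ y)) →
           ∀ w x → rank (map φ w) (φ x) ≡ rank w x
rank-map φ φ-<ᵇ []      x = refl
rank-map φ φ-<ᵇ (y ∷ w) x rewrite φ-<ᵇ y x with y ℕ.<ᵇ x
... | true  = cong suc (rank-map φ φ-<ᵇ w x)
... | false = rank-map φ φ-<ᵇ w x

standardise-map : ∀ φ → (∀ x y → (φ x ℕ.<ᵇ φ y) ≡ (x ℕ.<ᵇ y)) →
                  ∀ w → standardise (map φ w) ≡ standardise w
standardise-map φ φ-<ᵇ w = trans (sym (map-∘ w))
  (map-cong (λ x → cong suc (rank-map φ φ-<ᵇ w x)) w)

rank-zero : ∀ w → rank w 0 ≡ 0
rank-zero []      = refl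
rank-zero (x ∷ w) = rank-zero w

rank-deck : ∀ {n i} → i ℕ.< n → rank (deck n) (suc i) ≡ i
rank-deck {suc n} {i} (ℕ.s≤s i≤n) rewrite sym (map-applyUpTo suc suc n)
  with i | i≤n
... | zero  | _   = trans (rank-map suc (λ _ _ → refl) (deck n) 0) (rank-zero (deck n))
... | suc i | i<n = cong suc (trans (rank-map suc (λ _ _ → refl) (deck n) (suc i)) (rank-deck i<n))

-- Ranks do not depend on the order of the cards, and in `deck n` the card i + 1 has exactly i
-- smaller ones.
standardise-↭-deck : ∀ n u → u ↭ deck n → standardise u ≡ u
standardise-↭-deck n u u↭ = trans
  (map-cong-local (All-resp-↭ (↭-sym u↭) (applyUpTo⁺₁ suc n λ {i} i<n →
    cong suc (trans (rank-↭ u↭ (suc i)) (rank-deck i<n)))))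
  (map-id u)

-- Passing to the bottom cards.

ℙ^ : ℕ → Sequence → Sequence
ℙ^ zero    g = g
ℙ^ (suc d) g = ℙ (ℙ^ d g)

ℙ-cong : ∀ {g h} → (∀ j → g j ≡ h j) → ∀ j → ℙ g j ≡ ℙ h j
ℙ-cong g≗h j = cong₂ (λ a b → ι j * a + b) (g≗h (ℕ.pred j)) (g≗h j)

ℙ^-zero : ∀ d g → ℙ^ d g 0 ≡ g 0
ℙ^-zero zero    g = refl
ℙ^-zero (suc d) g = trans
  (solve 1 (λ a → con 0ℚ :* a :+ a := a) refl (ℙ^ d g 0))
  (ℙ^-zero d g)

Order-invariant-drop : ∀ f d → Order-invariant (λ w → f (standardise (drop d w)))
Order-invariant-drop f d i w = cong f (trans
  (cong standardise (drop-map d w))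
  (standardise-map (skip i) (skip-<ᵇ i) (drop d w)))

length-deck : ∀ n → length (deck n) ≡ n
length-deck = length-applyUpTo suc

-- Dropping d + 1 cards is dropping d cards from the tail, and standardisation makes that function
-- order-invariant, so each dropped card costs one ℙ. With none dropped, standardisation fixes all
-- rearrangements of `deck k`.
bottom-deck : ∀ f d k r →
  removeInsertSum r (λ w → f (standardise (drop d w))) (deck (d ℕ.+ k))
    ≡ ℙ^ d (λ s → removeInsertSum s f (deck k)) r
bottom-deck f zero k r =
  removeInsertSum-cong r (deck k) λ u u↭ → cong f (standardise-↭-deck k u u↭)
bottom-deck f (suc d) k r = begin
  removeInsertSum r (λ w → f (standardise (drop (suc d) w))) (deck (suc d ℕ.+ k))
    ≡⟨ removeInsertSum-cong r (deck (suc d ℕ.+ k)) tail-nonempty ⟩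
  removeInsertSum r (onTail F) (deck (suc d ℕ.+ k))
    ≡⟨ onTail-deck F (Order-invariant-drop f d) (d ℕ.+ k) r ⟩
  ℙ (λ s → removeInsertSum s F (deck (d ℕ.+ k))) r
    ≡⟨ ℙ-cong (bottom-deck f d k) r ⟩
  ℙ^ (suc d) (λ s → removeInsertSum s f (deck k)) r ∎
  where
  open ≡-Reasoning
  F : Deck → ℚ
  F w = f (standardise (drop d w))
  tail-nonempty : ∀ u → u ↭ deck (suc d ℕ.+ k) →
                  f (standardise (drop (suc d) u)) ≡ onTail F u
  tail-nonempty []      u↭ with ↭-length u↭
  ... | ()
  tail-nonempty (x ∷ u) _ = refl

-- Expectations and the dual action of kernels.

𝔼 : (Deck → ℚ) → Dist → ℚ
𝔼 f = sumOver λ (w , p) → p * f w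

indicator : Deck → Deck → ℚ
indicator w v = if does (≡-dec ℕP._≟_ w v) then 1ℚ else 0ℚ

mass≡𝔼 : ∀ w d → mass w d ≡ 𝔼 (indicator w) d
mass≡𝔼 w []            = refl
mass≡𝔼 w ((v , p) ∷ d) with does (≡-dec ℕP._≟_ w v)
... | true  = cong₂ _+_ (sym (*-identityʳ p)) (mass≡𝔼 w d)
... | false = cong₂ _+_ (sym (*-zeroʳ p)) (mass≡𝔼 w d)

𝔼-push : ∀ f g d → 𝔼 f (push g d) ≡ 𝔼 (λ w → f (g w)) d
𝔼-push f g []            = refl
𝔼-push f g ((v , p) ∷ d) = cong (p * f (g v) +_) (𝔼-push f g d)

sumOver-cong : {A : Set} {f g : A → ℚ} → (∀ x → f x ≡ g x) →
               ∀ xs → sumOver f xs ≡ sumOver g xs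
sumOver-cong eq []       = refl
sumOver-cong eq (x ∷ xs) = cong₂ _+_ (eq x) (sumOver-cong eq xs)

sumOver-++ : {A : Set} (f : A → ℚ) → ∀ xs ys →
             sumOver f (xs ++ ys) ≡ sumOver f xs + sumOver f ys
sumOver-++ f []       ys = sym (+-identityˡ (sumOver f ys))
sumOver-++ f (x ∷ xs) ys = trans (cong (f x +_) (sumOver-++ f xs ys))
  (sym (+-assoc (f x) (sumOver f xs) (sumOver f ys)))

sumOver-map : {A B : Set} (f : B → ℚ) (g : A → B) → ∀ xs →
              sumOver f (map g xs) ≡ sumOver (λ x → f (g x)) xs
sumOver-map f g []       = refl
sumOver-map f g (x ∷ xs) = cong (f (g x) +_) (sumOver-map f g xs)

sumOver-concatMap : {A B : Set} (f : B → ℚ) (g : A → List B) → ∀ xs →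
                    sumOver f (concatMap g xs) ≡ sumOver (λ x → sumOver f (g x)) xs
sumOver-concatMap f g []       = refl
sumOver-concatMap f g (x ∷ xs) = trans (sumOver-++ f (g x) (concatMap g xs))
  (cong (sumOver f (g x) +_) (sumOver-concatMap f g xs))

sumOver-* : {A : Set} (c : ℚ) (f : A → ℚ) → ∀ xs →
            sumOver (λ x → c * f x) xs ≡ c * sumOver f xs
sumOver-* c f []       = sym (*-zeroʳ c)
sumOver-* c f (x ∷ xs) = trans (cong (c * f x +_) (sumOver-* c f xs))
  (sym (*-distribˡ-+ c (f x) (sumOver f xs)))

scale : ℚ → Dist → Dist
scale c = map λ (u , r) → (u , c * r)

𝔼-scale : ∀ f c d → 𝔼 f (scale c d) ≡ c * 𝔼 f d
𝔼-scale f c d = trans (sumOver-map _ _ d) (trans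
  (sumOver-cong (λ (u , r) → *-assoc c r (f u)) d)
  (sumOver-* c _ d))

effect : Kernel → (Deck → ℚ) → Deck → ℚ
effect K f w = 𝔼 f (K w)

𝔼-step : ∀ f K d → 𝔼 f (step K d) ≡ 𝔼 (effect K f) d
𝔼-step f K d = trans (sumOver-concatMap _ _ d)
  (sumOver-cong (λ (v , p) → 𝔼-scale f p (K v)) d)

-- The outermost `step` of `iterate` is the first to be moved onto f, hence the recursion with f
-- changed.
effects : Kernel → ℕ → (Deck → ℚ) → Deck → ℚ
effects K zero    f = f
effects K (suc t) f = effects K t (effect K f)

𝔼-iterate : ∀ f K t d → 𝔼 f (iterate K t d) ≡ 𝔼 (effects K t f) d
𝔼-iterate f K zero    d = refl
𝔼-iterate f K (suc t) d = trans (𝔼-step f K (iterate K t d)) (𝔼-iterate (effect K f) K t d)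

𝔼-start : ∀ f n → 𝔼 f (start n) ≡ f (deck n)
𝔼-start f n rewrite map-upTo suc n =
  solve 1 (λ a → con 1ℚ :* a :+ con 0ℚ := a) refl (f (deck n))

𝔼-uniform : ∀ f ds → 𝔼 f (uniform ds) ≡ frac 1 (length ds) * sumOver f ds
𝔼-uniform f ds = trans (sumOver-map _ _ ds) (sumOver-* (frac 1 (length ds)) f ds)

-- The shuffles in terms of insertion sums.

sumOver-insertions : ∀ f x w → sumOver f (insertions x w) ≡ insertSum x f w
sumOver-insertions f x w = trans
  (cong (sumOver f) (map-upTo (λ i → insertAt i x w) (suc (length w))))
  (positions f w)
  where
  positions : ∀ f w → sumOver f (applyUpTo (λ i → insertAt i x w) (suc (length w)))
                      ≡ insertSum x f w
  positions f []      = +-identityʳ (f (x ∷ []))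
  positions f (y ∷ w) = cong (f (x ∷ y ∷ w) +_) (begin
    sumOver f (applyUpTo (λ i → y ∷ insertAt i x w) (suc (length w)))
      ≡⟨ cong (sumOver f) (map-applyUpTo (λ i → insertAt i x w) (y ∷_) (suc (length w))) ⟨
    sumOver f (map (y ∷_) (applyUpTo (λ i → insertAt i x w) (suc (length w))))
      ≡⟨ sumOver-map f (y ∷_) (applyUpTo (λ i → insertAt i x w) (suc (length w))) ⟩
    sumOver (λ v → f (y ∷ v)) (applyUpTo (λ i → insertAt i x w) (suc (length w)))
      ≡⟨ positions (λ v → f (y ∷ v)) w ⟩
    insertSum x (λ v → f (y ∷ v)) w ∎)
    where open ≡-Reasoning

-- `arrangements` inserts the first card of a last, which matches `removeInsertSum` absorbing that
-- insertion into f before the others.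
sumOver-arrangements : ∀ f a b →
  sumOver f (arrangements a b) ≡ removeInsertSum (length a) f (a ++ b)
sumOver-arrangements f []      b = +-identityʳ (f b)
sumOver-arrangements f (x ∷ a) b = begin
  sumOver f (concatMap (insertions x) (arrangements a b))
    ≡⟨ sumOver-concatMap f (insertions x) (arrangements a b) ⟩
  sumOver (λ u → sumOver f (insertions x u)) (arrangements a b)
    ≡⟨ sumOver-cong (sumOver-insertions f x) (arrangements a b) ⟩
  sumOver (insertSum x f) (arrangements a b)
    ≡⟨ sumOver-arrangements (insertSum x f) a b ⟩
  removeInsertSum (length a) (insertSum x f) (a ++ b) ∎
  where open ≡-Reasoning

effect-topToRandom : ∀ f x w →
  effect topToRandom f (x ∷ w) ≡ frac 1 (length (x ∷ w)) * topSum f (x ∷ w)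
effect-topToRandom f x w = trans (𝔼-uniform f (insertions x w))
  (cong₂ (λ l s → frac 1 l * s)
    (trans (length-map _ (upTo (suc (length w)))) (length-applyUpTo (λ i → i) (suc (length w))))
    (sumOver-insertions f x w))

effect-lazy : ∀ α K f w → effect (lazy α K) f w ≡ α * f w + (1ℚ - α) * effect K f w
effect-lazy α K f w = cong (α * f w +_) (𝔼-scale f (1ℚ - α) (K w))

-- Intertwining two chains through profiles.

profile : (Deck → ℚ) → ℕ → Sequence
profile f n r = removeInsertSum r f (deck n)

Supported : ℕ → Sequence → Set
Supported n g = ∀ j → n ℕ.< j → g j ≡ 0ℚ

profile-supported : ∀ f n → Supported n (profile f n)
profile-supported f n r n<r =
  removeInsertSum-vanishes r f (deck n) (subst (ℕ._< r) (sym (length-deck n)) n<r)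

ℙ^-cong : ∀ d {g h} → (∀ j → g j ≡ h j) → ∀ j → ℙ^ d g j ≡ ℙ^ d h j
ℙ^-cong zero    g≗h = g≗h
ℙ^-cong (suc d) g≗h = ℙ-cong (ℙ^-cong d g≗h)

ℙ-supported : ∀ {n g} → Supported n g → Supported (suc n) (ℙ g)
ℙ-supported {n} {g} g≡0 (suc j) (ℕ.s≤s n<j)
  rewrite g≡0 j n<j | g≡0 (suc j) (ℕP.m≤n⇒m≤1+n n<j) =
  solve 1 (λ i → i :* con 0ℚ :+ con 0ℚ := con 0ℚ) refl (ι (suc j))

ℙ^-supported : ∀ d {n g} → Supported n g → Supported (d ℕ.+ n) (ℙ^ d g)
ℙ^-supported zero    g≡0 = g≡0
ℙ^-supported (suc d) g≡0 = ℙ-supported (ℙ^-supported d g≡0)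

-- The invariant is that the two profiles correspond under `ℙ^ d`; replacing both functions by their
-- effects preserves it. At t = 0 it is read at index 0, where a profile is the value at the initial
-- deck and ℙ acts as the identity.
effects-intertwined : ∀ {K K′} d k (Λ Λ′ : Sequence → Sequence) →
  (∀ {g h} → (∀ j → g j ≡ h j) → ∀ j → Λ g j ≡ Λ h j) →
  (∀ f r → profile (effect K f) (d ℕ.+ k) r ≡ Λ (profile f (d ℕ.+ k)) r) →
  (∀ f r → profile (effect K′ f) k r ≡ Λ′ (profile f k) r) →
  (∀ {g} → Supported k g → ∀ r → Λ (ℙ^ d g) r ≡ ℙ^ d (Λ′ g) r) →
  ∀ t f f′ → (∀ r → profile f (d ℕ.+ k) r ≡ ℙ^ d (profile f′ k) r) →
  effects K t f (deck (d ℕ.+ k)) ≡ effects K′ t f′ (deck k)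
effects-intertwined d k Λ Λ′ Λ-cong K-acts K′-acts intertwine zero f f′ f~f′ =
  trans (f~f′ 0) (ℙ^-zero d (profile f′ k))
effects-intertwined {K} {K′} d k Λ Λ′ Λ-cong K-acts K′-acts intertwine (suc t) f f′ f~f′ =
  effects-intertwined d k Λ Λ′ Λ-cong K-acts K′-acts intertwine t (effect K f) (effect K′ f′) λ r →
  begin
    profile (effect K f) (d ℕ.+ k) r   ≡⟨ K-acts f r ⟩
    Λ (profile f (d ℕ.+ k)) r          ≡⟨ Λ-cong f~f′ r ⟩
    Λ (ℙ^ d (profile f′ k)) r          ≡⟨ intertwine (profile-supported f′ k) r ⟩
    ℙ^ d (Λ′ (profile f′ k)) r         ≡⟨ ℙ^-cong d (K′-acts f′) r ⟨
    ℙ^ d (profile (effect K′ f′) k) r  ∎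
  where open ≡-Reasoning

-- The top-to-random shuffle.

𝕏-cong : ∀ {g h} → (∀ j → g j ≡ h j) → ∀ j → 𝕏 g j ≡ 𝕏 h j
𝕏-cong g≗h j = cong₂ (λ a b → ι j * a + b) (g≗h j) (g≗h (suc j))

-- For functionals on polynomials, both sides send p(x) to the value at (x + 1)p(x + 1).
𝕏-ℙ : ∀ g j → 𝕏 (ℙ g) j ≡ ℙ (λ i → 𝕏 g i + g i) j
𝕏-ℙ g zero = solve 2 (λ a b →
    con 0ℚ :* (con 0ℚ :* a :+ a) :+ (con 1ℚ :* a :+ b)
      := con 0ℚ :* ((con 0ℚ :* a :+ b) :+ a) :+ ((con 0ℚ :* a :+ b) :+ a))
  refl (g 0) (g 1)
𝕏-ℙ g (suc j) rewrite ι-suc (suc j) | ι-suc j = solve 4 (λ i a b c →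
    (con 1ℚ :+ i) :* ((con 1ℚ :+ i) :* a :+ b) :+ ((con 1ℚ :+ (con 1ℚ :+ i)) :* b :+ c)
      := (con 1ℚ :+ i) :* ((i :* a :+ b) :+ a) :+ (((con 1ℚ :+ i) :* b :+ c) :+ b))
  refl (ι j) (g j) (g (suc j)) (g (suc (suc j)))

-- The operator c(a + 𝕏). With c = 1/n it describes the shuffle of n cards for a = 0 and the lazy
-- shuffle of k cards for a = n - k; moving it past ℙ raises a by one.
lazyShift : ℚ → ℕ → Sequence → Sequence
lazyShift c a g j = c * (ι a * g j + 𝕏 g j)

lazyShift-cong : ∀ c a {g h} → (∀ j → g j ≡ h j) → ∀ j → lazyShift c a g j ≡ lazyShift c a h j
lazyShift-cong c a g≗h j = cong₂ (λ x y → c * (ι a * x + y)) (g≗h j) (𝕏-cong g≗h j)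

lazyShift-ℙ : ∀ c a g j → lazyShift c a (ℙ g) j ≡ ℙ (lazyShift c (suc a) g) j
lazyShift-ℙ c a g j rewrite 𝕏-ℙ g j | ι-suc a = solve 7 (λ c a i x y u v →
    c :* (a :* (i :* x :+ y) :+ (i :* (u :+ x) :+ (v :+ y)))
      := i :* (c :* ((con 1ℚ :+ a) :* x :+ u)) :+ c :* ((con 1ℚ :+ a) :* y :+ v))
  refl c (ι a) (ι j) (g (ℕ.pred j)) (g j) (𝕏 g (ℕ.pred j)) (𝕏 g j)

lazyShift-ℙ^ : ∀ c d a g j → lazyShift c a (ℙ^ d g) j ≡ ℙ^ d (lazyShift c (d ℕ.+ a) g) j
lazyShift-ℙ^ c zero    a g j = refl
lazyShift-ℙ^ c (suc d) a g j = begin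
  lazyShift c a (ℙ (ℙ^ d g)) j             ≡⟨ lazyShift-ℙ c a (ℙ^ d g) j ⟩
  ℙ (lazyShift c (suc a) (ℙ^ d g)) j       ≡⟨ ℙ-cong (lazyShift-ℙ^ c d (suc a) g) j ⟩
  ℙ (ℙ^ d (lazyShift c (d ℕ.+ suc a) g)) j ≡⟨ cong (λ b → ℙ (ℙ^ d (lazyShift c b g)) j) (ℕP.+-suc d a) ⟩
  ℙ (ℙ^ d (lazyShift c (suc d ℕ.+ a) g)) j ∎
  where open ≡-Reasoning

profile-topToRandom : ∀ n → 1 ℕ.≤ n → ∀ f r →
  profile (effect topToRandom f) n r ≡ frac 1 n * 𝕏 (profile f n) r
profile-topToRandom n 1≤n f r = begin
  removeInsertSum r (effect topToRandom f) (deck n)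
    ≡⟨ removeInsertSum-cong r (deck n) effect-on-deck ⟩
  removeInsertSum r (λ u → frac 1 n * topSum f u) (deck n)
    ≡⟨ removeInsertSum-* (frac 1 n) r (topSum f) (deck n) ⟩
  frac 1 n * removeInsertSum r (topSum f) (deck n)
    ≡⟨ cong (frac 1 n *_) (removeInsertSum-topSum r f (deck n)) ⟩
  frac 1 n * 𝕏 (profile f n) r ∎
  where
  open ≡-Reasoning
  effect-on-deck : ∀ u → u ↭ deck n → effect topToRandom f u ≡ frac 1 n * topSum f u
  effect-on-deck []      u↭ = ⊥-elim (ℕP.<⇒≢ 1≤n (trans (↭-length u↭) (length-deck n)))
  effect-on-deck (x ∷ u) u↭ = trans (effect-topToRandom f x u)
    (cong (λ l → frac 1 l * topSum f (x ∷ u)) (trans (↭-length u↭) (length-deck n)))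

-- With n = d + k, the moving part has weight k/n and acts as 𝕏/k, so together they give 𝕏/n, with
-- the same constant as for n cards.
profile-lazy : ∀ d k → 1 ℕ.≤ k → ∀ f r →
  profile (effect (lazy (frac d (d ℕ.+ k)) topToRandom) f) k r
    ≡ lazyShift (frac 1 (d ℕ.+ k)) d (profile f k) r
profile-lazy d k 1≤k f r = begin
  removeInsertSum r (effect (lazy α topToRandom) f) (deck k)
    ≡⟨ removeInsertSum-cong r (deck k) (λ u _ → effect-lazy α topToRandom f u) ⟩
  removeInsertSum r (λ u → α * f u + (1ℚ - α) * effect topToRandom f u) (deck k)
    ≡⟨ removeInsertSum-+ r (λ u → α * f u) (λ u → (1ℚ - α) * effect topToRandom f u) (deck k) ⟩
  removeInsertSum r (λ u → α * f u) (deck k)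
    + removeInsertSum r (λ u → (1ℚ - α) * effect topToRandom f u) (deck k)
    ≡⟨ cong₂ _+_ (removeInsertSum-* α r f (deck k))
                 (removeInsertSum-* (1ℚ - α) r (effect topToRandom f) (deck k)) ⟩
  α * profile f k r + (1ℚ - α) * profile (effect topToRandom f) k r
    ≡⟨ cong (λ x → α * profile f k r + (1ℚ - α) * x) (profile-topToRandom k 1≤k f r) ⟩
  α * profile f k r + (1ℚ - α) * (frac 1 k * 𝕏 (profile f k) r)
    ≡⟨ weights (profile f k r) (𝕏 (profile f k) r) ⟩
  c * (ι d * profile f k r + 𝕏 (profile f k) r) ∎
  where
  open ≡-Reasoning
  n = d ℕ.+ k
  α = frac d n
  c = frac 1 n

  moving : (1ℚ - ι d * c) * frac 1 k ≡ c
  moving = begin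
    (1ℚ - ι d * c) * frac 1 k
      ≡⟨ cong (λ x → (x - ι d * c) * frac 1 k) (frac-inverse n (ℕP.≤-trans 1≤k (ℕP.m≤n+m k d))) ⟨
    (c * ι n - ι d * c) * frac 1 k
      ≡⟨ cong (λ x → (c * x - ι d * c) * frac 1 k) (ι-+ d k) ⟩
    (c * (ι d + ι k) - ι d * c) * frac 1 k
      ≡⟨ solve 4 (λ c d k e → (c :* (d :+ k) :- d :* c) :* e := c :* (e :* k)) refl c (ι d) (ι k) (frac 1 k) ⟩
    c * (frac 1 k * ι k)
      ≡⟨ cong (c *_) (frac-inverse k 1≤k) ⟩
    c * 1ℚ
      ≡⟨ *-identityʳ c ⟩
    c ∎

  weights : ∀ x y → α * x + (1ℚ - α) * (frac 1 k * y) ≡ c * (ι d * x + y)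
  weights x y = begin
    α * x + (1ℚ - α) * (frac 1 k * y)
      ≡⟨ cong (λ a → a * x + (1ℚ - a) * (frac 1 k * y)) (frac≡ι*frac d n) ⟩
    ι d * c * x + (1ℚ - ι d * c) * (frac 1 k * y)
      ≡⟨ cong (ι d * c * x +_) (*-assoc (1ℚ - ι d * c) (frac 1 k) y) ⟨
    ι d * c * x + (1ℚ - ι d * c) * frac 1 k * y
      ≡⟨ cong (λ z → ι d * c * x + z * y) moving ⟩
    ι d * c * x + c * y
      ≡⟨ solve 4 (λ c d x y → d :* c :* x :+ c :* y := c :* (d :* x :+ y)) refl c (ι d) x y ⟩
    c * (ι d * x + y) ∎

-- Falling factorials of 𝕏.

-- falling r = 𝕏 (𝕏 - 1) ⋯ (𝕏 - r + 1); the factors commute, and this order of composition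
-- is the one for which falling-vanishes is a direct induction.
falling : ℕ → Sequence → Sequence
falling zero    g = g
falling (suc r) g = falling r (λ j → 𝕏 g j + (- ι r) * g j)

falling-cong : ∀ r {g h} → (∀ j → g j ≡ h j) → ∀ j → falling r g j ≡ falling r h j
falling-cong zero    g≗h = g≗h
falling-cong (suc r) g≗h =
  falling-cong r λ j → cong₂ (λ a b → a + (- ι r) * b) (𝕏-cong g≗h j) (g≗h j)

falling-+ : ∀ r g h j → falling r (λ i → g i + h i) j ≡ falling r g j + falling r h j
falling-+ zero    g h j = refl
falling-+ (suc r) g h j = trans
  (falling-cong r (λ i → solve 6 (λ i a b c d r →
      (i :* (a :+ b) :+ (c :+ d)) :+ r :* (a :+ b)
        := ((i :* a :+ c) :+ r :* a) :+ ((i :* b :+ d) :+ r :* b))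
    refl (ι i) (g i) (h i) (g (suc i)) (h (suc i)) (- ι r)) j)
  (falling-+ r _ _ j)

-- Each factor shortens the support by one: at the last index n of the support, 𝕏 - n cancels n g n
-- and leaves g (n + 1) = 0.
falling-vanishes : ∀ n g → (∀ j → n ℕ.≤ j → g j ≡ 0ℚ) → ∀ j → falling n g j ≡ 0ℚ
falling-vanishes zero    g g≡0 j = g≡0 j ℕ.z≤n
falling-vanishes (suc n) g g≡0 = falling-vanishes n _ λ j n≤j → begin
  (ι j * g j + g (suc j)) + (- ι n) * g j
    ≡⟨ cong (λ x → (ι j * g j + x) + (- ι n) * g j) (g≡0 (suc j) (ℕ.s≤s n≤j)) ⟩
  (ι j * g j + 0ℚ) + (- ι n) * g j
    ≡⟨ cancels j (ℕP.m≤n⇒m<n∨m≡n n≤j) ⟩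
  0ℚ ∎
  where
  open ≡-Reasoning
  cancels : ∀ j → n ℕ.< j ⊎ n ≡ j → (ι j * g j + 0ℚ) + (- ι n) * g j ≡ 0ℚ
  cancels j (inj₁ n<j) rewrite g≡0 j n<j =
    solve 2 (λ i m → (i :* con 0ℚ :+ con 0ℚ) :+ (:- m) :* con 0ℚ := con 0ℚ) refl (ι j) (ι n)
  cancels j (inj₂ refl) =
    solve 2 (λ i a → (i :* a :+ con 0ℚ) :+ (:- i) :* a := con 0ℚ) refl (ι j) (g j)

-- This is Pascal's rule for falling factorials: at x + 1 the r-th one equals the r-th one at x plus
-- r times the (r - 1)-st. In the induction the factor 𝕏 - r passes ℙ as 𝕏 - r + 1.
falling-ℙ : ∀ r g j → falling r (ℙ g) j ≡ ℙ (λ i → falling r g i + ι r * falling (ℕ.pred r) g i) j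
falling-ℙ zero g j = solve 3 (λ i x y →
    i :* x :+ y := i :* (x :+ con 0ℚ :* x) :+ (y :+ con 0ℚ :* y))
  refl (ι j) (g (ℕ.pred j)) (g j)
falling-ℙ (suc r) g j = begin
  falling r (λ i → 𝕏 (ℙ g) i + (- ι r) * ℙ g i) j
    ≡⟨ falling-cong r shift j ⟩
  falling r (ℙ h) j
    ≡⟨ falling-ℙ r h j ⟩
  ℙ (λ i → falling r h i + ι r * falling (ℕ.pred r) h i) j
    ≡⟨ ℙ-cong (λ i → cong₂ _+_ (falling-+ r (λ i → 𝕏 g i + (- ι r) * g i) g i) (lower r i)) j ⟩
  ℙ (λ i → (falling (suc r) g i + falling r g i) + ι r * falling r g i) j
    ≡⟨ ℙ-cong (λ i → solve 3 (λ a b r → (a :+ b) :+ r :* b := a :+ (con 1ℚ :+ r) :* b)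
         refl (falling (suc r) g i) (falling r g i) (ι r)) j ⟩
  ℙ (λ i → falling (suc r) g i + (1ℚ + ι r) * falling r g i) j
    ≡⟨ cong (λ s → ℙ (λ i → falling (suc r) g i + s * falling r g i) j) (ι-suc r) ⟨
  ℙ (λ i → falling (suc r) g i + ι (suc r) * falling r g i) j ∎
  where
  open ≡-Reasoning
  h : Sequence
  h i = (𝕏 g i + (- ι r) * g i) + g i

  shift : ∀ i → 𝕏 (ℙ g) i + (- ι r) * ℙ g i ≡ ℙ h i
  shift i rewrite 𝕏-ℙ g i = solve 6 (λ i r x y u v →
      (i :* (u :+ x) :+ (v :+ y)) :+ r :* (i :* x :+ y)
        := i :* ((u :+ r :* x) :+ x) :+ ((v :+ r :* y) :+ y))
    refl (ι i) (- ι r) (g (ℕ.pred i)) (g i) (𝕏 g (ℕ.pred i)) (𝕏 g i)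

  -- The extra factor is 𝕏 - (s - 1), exactly the one that extends `falling (s - 1)` to `falling s`;
  -- at s = 0 both sides carry the coefficient 0.
  lower : ∀ s i → ι s * falling (ℕ.pred s) (λ i → (𝕏 g i + (- ι s) * g i) + g i) i ≡ ι s * falling s g i
  lower zero    i = trans (*-zeroˡ ((𝕏 g i + (- ι 0) * g i) + g i)) (sym (*-zeroˡ (g i)))
  lower (suc s) i = cong (ι (suc s) *_) (falling-cong s (λ l → trans
    (cong (λ x → (𝕏 g l + (- x) * g l) + g l) (ι-suc s))
    (solve 3 (λ x s y → (x :+ (:- (con 1ℚ :+ s)) :* y) :+ y := x :+ (:- s) :* y)
      refl (𝕏 g l) (ι s) (g l))) i)

-- Solving `removeInsertSum-topSum` for its last term expresses moving r + 1 cards as moving r cards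
-- with f replaced by `topSum f` minus r times f. On profiles this replacement is the factor 𝕏 - r.
removeInsertSum-falling : ∀ j r f w →
  removeInsertSum j (removeInsertSum r f) w ≡ falling r (λ s → removeInsertSum s f w) j
removeInsertSum-falling j zero    f w = refl
removeInsertSum-falling j (suc r) f w = begin
  removeInsertSum j (removeInsertSum (suc r) f) w
    ≡⟨ removeInsertSum-cong j w (λ v _ → split v) ⟩
  removeInsertSum j (removeInsertSum r f′) w
    ≡⟨ removeInsertSum-falling j r f′ w ⟩
  falling r (λ s → removeInsertSum s f′ w) j
    ≡⟨ falling-cong r (λ s → trans (expand s w)
         (cong (_+ (- ι r) * removeInsertSum s f w) (removeInsertSum-topSum s f w))) j ⟩
  falling (suc r) (λ s → removeInsertSum s f w) j ∎
  where
  open ≡-Reasoning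
  f′ : Deck → ℚ
  f′ u = topSum f u + (- ι r) * f u

  expand : ∀ s v → removeInsertSum s f′ v
                   ≡ removeInsertSum s (topSum f) v + (- ι r) * removeInsertSum s f v
  expand s v = trans (removeInsertSum-+ s (topSum f) (λ u → (- ι r) * f u) v)
    (cong (removeInsertSum s (topSum f) v +_) (removeInsertSum-* (- ι r) s f v))

  split : ∀ v → removeInsertSum (suc r) f v ≡ removeInsertSum r f′ v
  split v = begin
    removeInsertSum (suc r) f v
      ≡⟨ solve 3 (λ r a b → b := (r :* a :+ b) :+ (:- r) :* a) refl
           (ι r) (removeInsertSum r f v) (removeInsertSum (suc r) f v) ⟩
    𝕏 (λ s → removeInsertSum s f v) r + (- ι r) * removeInsertSum r f v
      ≡⟨ cong (_+ (- ι r) * removeInsertSum r f v) (removeInsertSum-topSum r f v) ⟨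
    removeInsertSum r (topSum f) v + (- ι r) * removeInsertSum r f v
      ≡⟨ expand r v ⟨
    removeInsertSum r f′ v ∎

-- The binomial shuffle as an operator on profiles.

-- The sum of p^r q^(n - r) e r over r from 0 to n.
homogeneousSum : ℚ → ℚ → ℕ → Sequence → ℚ
homogeneousSum p q zero    e = e 0
homogeneousSum p q (suc n) e = powℚ q (suc n) * e 0 + p * homogeneousSum p q n (λ r → e (suc r))

homogeneousSum-cong : ∀ p q n {e e′} → (∀ r → e r ≡ e′ r) →
                      homogeneousSum p q n e ≡ homogeneousSum p q n e′
homogeneousSum-cong p q zero    eq = eq 0
homogeneousSum-cong p q (suc n) eq = cong₂ (λ a b → powℚ q (suc n) * a + p * b) (eq 0)
  (homogeneousSum-cong p q n λ r → eq (suc r))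

homogeneousSum-linear : ∀ p q n a e e′ →
  homogeneousSum p q n (λ r → a * e r + e′ r)
    ≡ a * homogeneousSum p q n e + homogeneousSum p q n e′
homogeneousSum-linear p q zero    a e e′ = refl
homogeneousSum-linear p q (suc n) a e e′ = trans
  (cong (λ x → powℚ q (suc n) * (a * e 0 + e′ 0) + p * x)
    (homogeneousSum-linear p q n a (λ r → e (suc r)) (λ r → e′ (suc r))))
  (solve 7 (λ Q p a x y u v →
      Q :* (a :* x :+ y) :+ p :* (a :* u :+ v) := a :* (Q :* x :+ p :* u) :+ (Q :* y :+ p :* v))
    refl (powℚ q (suc n)) p a (e 0) (e′ 0) _ _)

homogeneousSum-last : ∀ p q n e →
  homogeneousSum p q (suc n) e ≡ q * homogeneousSum p q n e + powℚ p (suc n) * e (suc n)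
homogeneousSum-last p q zero e =
  solve 4 (λ p q x y → (q :* con 1ℚ) :* x :+ p :* y := q :* x :+ (p :* con 1ℚ) :* y)
    refl p q (e 0) (e 1)
homogeneousSum-last p q (suc n) e = trans
  (cong (λ x → powℚ q (suc (suc n)) * e 0 + p * x) (homogeneousSum-last p q n (λ r → e (suc r))))
  (solve 7 (λ p q P Q x u y →
      (q :* Q) :* x :+ p :* (q :* u :+ P :* y) := q :* (Q :* x :+ p :* u) :+ (p :* P) :* y)
    refl p q (powℚ p (suc n)) (powℚ q (suc n)) (e 0) _ (e (suc (suc n))))

-- The terms e r, with the last one vanishing, give q times the shorter sum; the terms shifted by
-- one give p times it. The weights p and q add up to 1.
homogeneousSum-pascal : ∀ q n e e′ → e′ 0 ≡ e 0 → (∀ r → e′ (suc r) ≡ e (suc r) + e r) →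
  e (suc n) ≡ 0ℚ → homogeneousSum (1ℚ - q) q (suc n) e′ ≡ homogeneousSum (1ℚ - q) q n e
homogeneousSum-pascal q n e e′ first pascal last = begin
  powℚ q (suc n) * e′ 0 + p * H n (λ r → e′ (suc r))
    ≡⟨ cong₂ (λ a b → powℚ q (suc n) * a + p * b) first
         (trans (homogeneousSum-cong p q n (λ r → trans (pascal r)
                  (cong (_+ e r) (sym (*-identityˡ (e (suc r)))))))
                (homogeneousSum-linear p q n 1ℚ (λ r → e (suc r)) e)) ⟩
  powℚ q (suc n) * e 0 + p * (1ℚ * H n (λ r → e (suc r)) + H n e)
    ≡⟨ solve 4 (λ a p b c → a :+ p :* (con 1ℚ :* b :+ c) := (a :+ p :* b) :+ p :* c) refl
         (powℚ q (suc n) * e 0) p (H n (λ r → e (suc r))) (H n e) ⟩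
  H (suc n) e + p * H n e
    ≡⟨ cong (_+ p * H n e) (homogeneousSum-last p q n e) ⟩
  (q * H n e + powℚ p (suc n) * e (suc n)) + p * H n e
    ≡⟨ cong (λ x → (q * H n e + powℚ p (suc n) * x) + p * H n e) last ⟩
  (q * H n e + powℚ p (suc n) * 0ℚ) + p * H n e
    ≡⟨ solve 3 (λ q P h → (q :* h :+ P :* con 0ℚ) :+ (con 1ℚ :- q) :* h := h) refl
         q (powℚ p (suc n)) (H n e) ⟩
  H n e ∎
  where
  open ≡-Reasoning
  p = 1ℚ - q
  H = homogeneousSum p q

inverseFactorial : ℕ → ℚ
inverseFactorial zero    = 1ℚ
inverseFactorial (suc r) = frac 1 (suc r) * inverseFactorial r

inverseFactorial-suc : ∀ r → inverseFactorial (suc r) * ι (suc r) ≡ inverseFactorial r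
inverseFactorial-suc r = begin
  frac 1 (suc r) * c * ι (suc r)
    ≡⟨ solve 3 (λ a c i → a :* c :* i := a :* i :* c) refl (frac 1 (suc r)) c (ι (suc r)) ⟩
  frac 1 (suc r) * ι (suc r) * c
    ≡⟨ cong (_* c) (frac-inverse (suc r) (ℕ.s≤s ℕ.z≤n)) ⟩
  1ℚ * c
    ≡⟨ *-identityˡ c ⟩
  c ∎
  where
  open ≡-Reasoning
  c = inverseFactorial r

inverseFactorial-! : ∀ r → inverseFactorial r * ι (r !) ≡ 1ℚ
inverseFactorial-! zero    = refl
inverseFactorial-! (suc r) = begin
  inverseFactorial (suc r) * ι (suc r ℕ.* r !)
    ≡⟨ cong (inverseFactorial (suc r) *_) (ι-* (suc r) (r !)) ⟩
  inverseFactorial (suc r) * (ι (suc r) * ι (r !))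
    ≡⟨ *-assoc (inverseFactorial (suc r)) (ι (suc r)) (ι (r !)) ⟨
  inverseFactorial (suc r) * ι (suc r) * ι (r !)
    ≡⟨ cong (_* ι (r !)) (inverseFactorial-suc r) ⟩
  inverseFactorial r * ι (r !)
    ≡⟨ inverseFactorial-! r ⟩
  1ℚ ∎
  where open ≡-Reasoning

-- For functionals, multiplication by the sum of p^r q^(n - r) times the binomial coefficient of x
-- over r, with p = 1 - q.
binomialShift : ℚ → ℕ → Sequence → Sequence
binomialShift q n g j = homogeneousSum (1ℚ - q) q n (λ r → inverseFactorial r * falling r g j)

binomialShift-cong : ∀ q n {g h} → (∀ j → g j ≡ h j) →
                     ∀ j → binomialShift q n g j ≡ binomialShift q n h j
binomialShift-cong q n g≗h j = homogeneousSum-cong (1ℚ - q) q n λ r →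
  cong (inverseFactorial r *_) (falling-cong r g≗h j)

-- Dividing `falling-ℙ` by r! gives Pascal's rule for the summands, and the support of g kills the
-- summand n + 1, so `homogeneousSum-pascal` applies with q unchanged.
binomialShift-ℙ : ∀ q n {g} → Supported n g →
                  ∀ j → binomialShift q (suc n) (ℙ g) j ≡ ℙ (binomialShift q n g) j
binomialShift-ℙ q n {g} g≡0 j = trans
  (homogeneousSum-pascal q n e e′ first pascal last)
  (homogeneousSum-linear (1ℚ - q) q n (ι j) _ _)
  where
  open ≡-Reasoning
  e e′ : Sequence
  e r = ℙ (λ i → inverseFactorial r * falling r g i) j
  e′ r = inverseFactorial r * falling r (ℙ g) j

  first : e′ 0 ≡ e 0
  first = solve 3 (λ i x y → con 1ℚ :* (i :* x :+ y) := i :* (con 1ℚ :* x) :+ con 1ℚ :* y)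
    refl (ι j) (g (ℕ.pred j)) (g j)

  pascal : ∀ r → e′ (suc r) ≡ e (suc r) + e r
  pascal r = begin
    c * falling (suc r) (ℙ g) j
      ≡⟨ cong (c *_) (falling-ℙ (suc r) g j) ⟩
    c * (ι j * (x + ι (suc r) * u) + (y + ι (suc r) * v))
      ≡⟨ solve 7 (λ c i r x y u v →
             c :* (i :* (x :+ r :* u) :+ (y :+ r :* v))
               := (i :* (c :* x) :+ c :* y) :+ (i :* (c :* r :* u) :+ c :* r :* v))
           refl c (ι j) (ι (suc r)) x y u v ⟩
    e (suc r) + (ι j * (c * ι (suc r) * u) + c * ι (suc r) * v)
      ≡⟨ cong (λ b → e (suc r) + (ι j * (b * u) + b * v)) (inverseFactorial-suc r) ⟩
    e (suc r) + e r ∎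
    where
    c = inverseFactorial (suc r)
    x = falling (suc r) g (ℕ.pred j)
    y = falling (suc r) g j
    u = falling r g (ℕ.pred j)
    v = falling r g j

  last : e (suc n) ≡ 0ℚ
  last = trans
    (cong₂ (λ x y → ι j * (c * x) + c * y)
      (falling-vanishes (suc n) g g≡0 (ℕ.pred j)) (falling-vanishes (suc n) g g≡0 j))
    (solve 2 (λ i c → i :* (c :* con 0ℚ) :+ c :* con 0ℚ := con 0ℚ) refl (ι j) c)
    where c = inverseFactorial (suc n)

binomialShift-ℙ^ : ∀ q d k {g} → Supported k g →
                   ∀ j → binomialShift q (d ℕ.+ k) (ℙ^ d g) j ≡ ℙ^ d (binomialShift q k g) j
binomialShift-ℙ^ q zero    k g≡0 j = refl
binomialShift-ℙ^ q (suc d) k g≡0 j = trans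
  (binomialShift-ℙ q (d ℕ.+ k) (ℙ^-supported d g≡0) j)
  (ℙ-cong (binomialShift-ℙ^ q d k g≡0) j)

-- Counting arrangements; weights of the binomial shuffle.

insertSum-one : ∀ x w → insertSum x (λ _ → 1ℚ) w ≡ ι (suc (length w))
insertSum-one x []      = refl
insertSum-one x (y ∷ w) = trans (cong (1ℚ +_) (insertSum-one x w)) (sym (ι-suc (suc (length w))))

-- The top card, inserted last, has as many places as there are cards, wherever the others went. The
-- denominator of n!/(n - r)! is multiplied out.
removeInsertSum-one : ∀ r w → r ℕ.≤ length w →
  removeInsertSum r (λ _ → 1ℚ) w * ι ((length w ∸ r) !) ≡ ι (length w !)
removeInsertSum-one zero    w       _            = *-identityˡ (ι (length w !))
removeInsertSum-one (suc r) (x ∷ w) (ℕ.s≤s r≤n) = begin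
  removeInsertSum r (insertSum x (λ _ → 1ℚ)) w * ι ((n ∸ r) !)
    ≡⟨ cong (_* ι ((n ∸ r) !)) (removeInsertSum-cong r w positions) ⟩
  removeInsertSum r (λ _ → ι (suc n) * 1ℚ) w * ι ((n ∸ r) !)
    ≡⟨ cong (_* ι ((n ∸ r) !)) (removeInsertSum-* (ι (suc n)) r (λ _ → 1ℚ) w) ⟩
  ι (suc n) * removeInsertSum r (λ _ → 1ℚ) w * ι ((n ∸ r) !)
    ≡⟨ *-assoc (ι (suc n)) (removeInsertSum r (λ _ → 1ℚ) w) (ι ((n ∸ r) !)) ⟩
  ι (suc n) * (removeInsertSum r (λ _ → 1ℚ) w * ι ((n ∸ r) !))
    ≡⟨ cong (ι (suc n) *_) (removeInsertSum-one r w r≤n) ⟩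
  ι (suc n) * ι (n !)
    ≡⟨ ι-* (suc n) (n !) ⟨
  ι (suc n !) ∎
  where
  open ≡-Reasoning
  n = length w
  positions : ∀ v → v ↭ w → insertSum x (λ _ → 1ℚ) v ≡ ι (suc n) * 1ℚ
  positions v v↭w = trans (insertSum-one x v)
    (trans (cong (λ l → ι (suc l)) (↭-length v↭w)) (sym (*-identityʳ (ι (suc n)))))

ι-length : {A : Set} (xs : List A) → ι (length xs) ≡ sumOver (λ _ → 1ℚ) xs
ι-length []       = refl
ι-length (x ∷ xs) = trans (ι-suc (length xs)) (cong (1ℚ +_) (ι-length xs))

arrangementsOfTop : ℕ → Deck → List Deck
arrangementsOfTop r w = arrangements (proj₁ (splitAt r w)) (proj₂ (splitAt r w))

sumOver-arrangementsOfTop : ∀ f r w → r ℕ.≤ length w →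
  sumOver f (arrangementsOfTop r w) ≡ removeInsertSum r f w
sumOver-arrangementsOfTop f r w r≤n rewrite splitAt-defn r w = trans
  (sumOver-arrangements f (take r w) (drop r w))
  (cong₂ (λ l v → removeInsertSum l f v)
    (trans (length-take r w) (ℕP.m≤n⇒m⊓n≡m r≤n))
    (take++drop≡id r w))

C-factorials : ∀ {n r} → r ℕ.≤ n → ι (n !) ≡ ι (n C r) * (ι (r !) * ι ((n ∸ r) !))
C-factorials {n} {r} r≤n = begin
  ι (n !)
    ≡⟨ cong ι (m/n*n≡m (k![n∸k]!∣n! r≤n)) ⟨
  ι (((n !) ℕ./ (r ! ℕ.* (n ∸ r) !)) ℕ.* (r ! ℕ.* (n ∸ r) !))
    ≡⟨ cong (λ c → ι (c ℕ.* (r ! ℕ.* (n ∸ r) !))) (nCk≡n!/k![n-k]! r≤n) ⟨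
  ι ((n C r) ℕ.* (r ! ℕ.* (n ∸ r) !))
    ≡⟨ ι-* (n C r) (r ! ℕ.* (n ∸ r) !) ⟩
  ι (n C r) * ι (r ! ℕ.* (n ∸ r) !)
    ≡⟨ cong (ι (n C r) *_) (ι-* (r !) ((n ∸ r) !)) ⟩
  ι (n C r) * (ι (r !) * ι ((n ∸ r) !)) ∎
  where
  open ≡-Reasoning
  instance _ = ℕP._!*_!≢0 r (n ∸ r)

-- Since `frac 1 0` is 0, cancelling the number of arrangements requires it to be positive; this is
-- read off from the factorial identity for that number.
left-invertible⇒positive : ∀ x n → x * ι n ≡ 1ℚ → 1 ℕ.≤ n
left-invertible⇒positive x (suc n) _ = ℕ.s≤s ℕ.z≤n
left-invertible⇒positive x zero    x*0≡1 with trans (sym (*-zeroʳ x)) x*0≡1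
... | ()

-- The binomial coefficient over the number n!/(n - r)! of arrangements is 1/r!, which no longer
-- depends on n.
C*frac-arrangements : ∀ r w → r ℕ.≤ length w →
  ι (length w C r) * frac 1 (length (arrangementsOfTop r w)) ≡ inverseFactorial r
C*frac-arrangements r w r≤n = begin
  ι (n C r) * a
    -- The two factors 1 become r!/r! and (n - r)!/(n - r)!, supplying the factorials that
    -- `C-factorials` consumes.
    ≡⟨ solve 2 (λ m a → m :* a := m :* a :* con 1ℚ :* con 1ℚ) refl (ι (n C r)) a ⟩
  ι (n C r) * a * 1ℚ * 1ℚ
    ≡⟨ cong₂ (λ x y → ι (n C r) * a * x * y) (inverseFactorial-! r) (inverseFactorial-! (n ∸ r)) ⟨
  ι (n C r) * a * (c * ι (r !)) * (k * ι ((n ∸ r) !))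
    ≡⟨ solve 6 (λ m a c f k g → m :* a :* (c :* f) :* (k :* g) := a :* c :* k :* (m :* (f :* g)))
         refl (ι (n C r)) a c (ι (r !)) k (ι ((n ∸ r) !)) ⟩
  a * c * k * (ι (n C r) * (ι (r !) * ι ((n ∸ r) !)))
    ≡⟨ cong (a * c * k *_) (trans size (C-factorials r≤n)) ⟨
  a * c * k * (ι l * ι ((n ∸ r) !))
    ≡⟨ solve 5 (λ a c k b g → a :* c :* k :* (b :* g) := c :* (a :* b) :* (k :* g))
         refl a c k (ι l) (ι ((n ∸ r) !)) ⟩
  c * (a * ι l) * (k * ι ((n ∸ r) !))
    ≡⟨ cong₂ (λ x y → c * x * y) (frac-inverse l l-positive) (inverseFactorial-! (n ∸ r)) ⟩
  c * 1ℚ * 1ℚ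
    ≡⟨ solve 1 (λ c → c :* con 1ℚ :* con 1ℚ := c) refl c ⟩
  c ∎
  where
  open ≡-Reasoning
  n = length w
  l = length (arrangementsOfTop r w)
  a = frac 1 l
  c = inverseFactorial r
  k = inverseFactorial (n ∸ r)

  size : ι l * ι ((n ∸ r) !) ≡ ι (n !)
  size = trans
    (cong (_* ι ((n ∸ r) !)) (trans (ι-length (arrangementsOfTop r w))
      (sumOver-arrangementsOfTop (λ _ → 1ℚ) r w r≤n)))
    (removeInsertSum-one r w r≤n)

  l-positive : 1 ℕ.≤ l
  l-positive = left-invertible⇒positive (inverseFactorial n * ι ((n ∸ r) !)) l (begin
    inverseFactorial n * ι ((n ∸ r) !) * ι l
      ≡⟨ solve 3 (λ i g b → i :* g :* b := i :* (b :* g)) refl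
           (inverseFactorial n) (ι ((n ∸ r) !)) (ι l) ⟩
    inverseFactorial n * (ι l * ι ((n ∸ r) !))
      ≡⟨ cong (inverseFactorial n *_) size ⟩
    inverseFactorial n * ι (n !)
      ≡⟨ inverseFactorial-! n ⟩
    1ℚ ∎)

-- The induction replaces `index` by its shift and moves one factor p into c, so both are arbitrary.
sumOver-applyUpTo : ∀ p q {A : Set} (h : A → ℚ) n (index : ℕ → A) c e →
  (∀ r → r ℕ.≤ n → h (index r) ≡ c * (powℚ p r * powℚ q (n ∸ r) * e r)) →
  sumOver h (applyUpTo index (suc n)) ≡ c * homogeneousSum p q n e
sumOver-applyUpTo p q h zero index c e weights = trans
  (cong (_+ 0ℚ) (weights 0 ℕ.z≤n))
  (solve 2 (λ c x → c :* (con 1ℚ :* con 1ℚ :* x) :+ con 0ℚ := c :* x) refl c (e 0))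
sumOver-applyUpTo p q h (suc n) index c e weights = trans
  (cong₂ _+_ (weights 0 ℕ.z≤n)
    (sumOver-applyUpTo p q h n (λ r → index (suc r)) (c * p) (λ r → e (suc r)) λ r r≤n → trans
      (weights (suc r) (ℕ.s≤s r≤n))
      (solve 5 (λ c p P Q x → c :* (p :* P :* Q :* x) := c :* p :* (P :* Q :* x)) refl
        c p (powℚ p r) (powℚ q (n ∸ r)) (e (suc r)))))
  (solve 5 (λ c p Q x s → c :* (con 1ℚ :* Q :* x) :+ c :* p :* s := c :* (Q :* x :+ p :* s)) refl
    c p (powℚ q (suc n)) (e 0) _)

effect-binomialTopToRandom : ∀ q f w →
  effect (binomialTopToRandom q) f w
    ≡ homogeneousSum (1ℚ - q) q (length w) (λ r → inverseFactorial r * removeInsertSum r f w)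
effect-binomialTopToRandom q f w = trans
  (sumOver-concatMap (λ (u , p) → p * f u) layer (upTo (suc n)))
  (trans
    (sumOver-applyUpTo (1ℚ - q) q (λ r → 𝔼 f (layer r)) n (λ r → r) 1ℚ e λ r r≤n → trans
      (𝔼-scale f (probability r) (uniform (arrangementsOfTop r w)))
      (weight r r≤n))
    (*-identityˡ (homogeneousSum (1ℚ - q) q n e)))
  where
  open ≡-Reasoning
  n = length w
  e : Sequence
  e r = inverseFactorial r * removeInsertSum r f w
  probability : Sequence
  probability r = ι (n C r) * powℚ (1ℚ - q) r * powℚ q (n ∸ r)
  layer : ℕ → Dist
  layer r = scale (probability r) (uniform (arrangementsOfTop r w))
  weight : ∀ r → r ℕ.≤ n →
    probability r * 𝔼 f (uniform (arrangementsOfTop r w))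
      ≡ 1ℚ * (powℚ (1ℚ - q) r * powℚ q (n ∸ r) * e r)
  weight r r≤n = begin
    m * P * Q * 𝔼 f (uniform (arrangementsOfTop r w))
      ≡⟨ cong (m * P * Q *_) (trans (𝔼-uniform f (arrangementsOfTop r w))
           (cong (a *_) (sumOver-arrangementsOfTop f r w r≤n))) ⟩
    m * P * Q * (a * s)
      ≡⟨ solve 5 (λ m P Q a s → m :* P :* Q :* (a :* s) := con 1ℚ :* (P :* Q :* (m :* a :* s)))
           refl m P Q a s ⟩
    1ℚ * (P * Q * (m * a * s))
      ≡⟨ cong (λ x → 1ℚ * (P * Q * (x * s))) (C*frac-arrangements r w r≤n) ⟩
    1ℚ * (P * Q * (inverseFactorial r * s)) ∎
    where
    m = ι (n C r)
    P = powℚ (1ℚ - q) r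
    Q = powℚ q (n ∸ r)
    a = frac 1 (length (arrangementsOfTop r w))
    s = removeInsertSum r f w

removeInsertSum-homogeneousSum : ∀ p q n j (e : ℕ → Deck → ℚ) w →
  removeInsertSum j (λ v → homogeneousSum p q n (λ r → e r v)) w
    ≡ homogeneousSum p q n (λ r → removeInsertSum j (e r) w)
removeInsertSum-homogeneousSum p q zero    j e w = refl
removeInsertSum-homogeneousSum p q (suc n) j e w = trans
  (removeInsertSum-+ j (λ v → powℚ q (suc n) * e 0 v)
    (λ v → p * homogeneousSum p q n (λ r → e (suc r) v)) w)
  (cong₂ _+_
    (removeInsertSum-* (powℚ q (suc n)) j (e 0) w)
    (trans
      (removeInsertSum-* p j (λ v → homogeneousSum p q n (λ r → e (suc r) v)) w)
      (cong (p *_) (removeInsertSum-homogeneousSum p q n j (λ r → e (suc r)) w))))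

profile-binomial : ∀ q n f j →
  profile (effect (binomialTopToRandom q) f) n j ≡ binomialShift q n (profile f n) j
profile-binomial q n f j = begin
  removeInsertSum j (effect (binomialTopToRandom q) f) (deck n)
    ≡⟨ removeInsertSum-cong j (deck n) (λ u u↭ → trans (effect-binomialTopToRandom q f u)
         (cong (λ l → homogeneousSum (1ℚ - q) q l (λ r → e r u))
           (trans (↭-length u↭) (length-deck n)))) ⟩
  removeInsertSum j (λ u → homogeneousSum (1ℚ - q) q n (λ r → e r u)) (deck n)
    ≡⟨ removeInsertSum-homogeneousSum (1ℚ - q) q n j e (deck n) ⟩
  homogeneousSum (1ℚ - q) q n (λ r → removeInsertSum j (e r) (deck n))
    ≡⟨ homogeneousSum-cong (1ℚ - q) q n (λ r → trans
         (removeInsertSum-* (inverseFactorial r) j (removeInsertSum r f) (deck n))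
         (cong (inverseFactorial r *_) (removeInsertSum-falling j r f (deck n)))) ⟩
  binomialShift q n (profile f n) j ∎
  where
  open ≡-Reasoning
  e : ℕ → Deck → ℚ
  e r u = inverseFactorial r * removeInsertSum r f u

-- From functions back to distributions.

bottom-lumps : ∀ {K K′} d k t →
  (∀ f → effects K t (λ w → f (standardise (drop d w))) (deck (d ℕ.+ k)) ≡ effects K′ t f (deck k)) →
  push (λ w → standardise (drop d w)) (iterate K t (start (d ℕ.+ k))) ≈ᴰ iterate K′ t (start k)
bottom-lumps {K} {K′} d k t effects≡ w = begin
  mass w (push bottom-k (iterate K t (start n)))
    ≡⟨ mass≡𝔼 w (push bottom-k (iterate K t (start n))) ⟩
  𝔼 (indicator w) (push bottom-k (iterate K t (start n)))
    ≡⟨ 𝔼-push (indicator w) bottom-k (iterate K t (start n)) ⟩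
  𝔼 f (iterate K t (start n))
    ≡⟨ 𝔼-iterate f K t (start n) ⟩
  𝔼 (effects K t f) (start n)
    ≡⟨ 𝔼-start (effects K t f) n ⟩
  effects K t f (deck n)
    ≡⟨ effects≡ (indicator w) ⟩
  effects K′ t (indicator w) (deck k)
    ≡⟨ 𝔼-start (effects K′ t (indicator w)) k ⟨
  𝔼 (effects K′ t (indicator w)) (start k)
    ≡⟨ 𝔼-iterate (indicator w) K′ t (start k) ⟨
  𝔼 (indicator w) (iterate K′ t (start k))
    ≡⟨ mass≡𝔼 w (iterate K′ t (start k)) ⟨
  mass w (iterate K′ t (start k)) ∎
  where
  open ≡-Reasoning
  n = d ℕ.+ k
  bottom-k : Deck → Deck
  bottom-k v = standardise (drop d v)
  f : Deck → ℚ
  f v = indicator w (bottom-k v)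

-- Taking n as d + k through an equation lets `refl` turn the truncated difference into d.
topToRandom-lumps : ∀ {n} d k t → d ℕ.+ k ≡ n → 1 ≤ k →
  push (λ w → standardise (bottom n k w)) (iterate topToRandom t (start n))
    ≈ᴰ iterate (lazy (frac (n ∸ k) n) topToRandom) t (start k)
topToRandom-lumps d k t refl 1≤k rewrite ℕP.m+n∸n≡m d k =
  bottom-lumps d k t λ f → effects-intertwined d k
    -- No laziness on n cards becomes laziness d on k cards after d copies of ℙ, with the same
    -- constant 1/n.
    (lazyShift c 0) (lazyShift c d) (lazyShift-cong c 0)
    (λ f r → trans (profile-topToRandom (d ℕ.+ k) (ℕP.≤-trans 1≤k (ℕP.m≤n+m k d)) f r)
      (solve 3 (λ c x y → c :* y := c :* (con 0ℚ :* x :+ y)) refl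
        c (profile f (d ℕ.+ k) r) (𝕏 (profile f (d ℕ.+ k)) r)))
    (profile-lazy d k 1≤k)
    (λ {g} _ r → trans (lazyShift-ℙ^ c d 0 g r)
      (cong (λ a → ℙ^ d (lazyShift c a g) r) (ℕP.+-identityʳ d)))
    t _ f (bottom-deck f d k)
  where c = frac 1 (d ℕ.+ k)

binomialTopToRandom-lumps : ∀ {n} d k t q → d ℕ.+ k ≡ n →
  push (λ w → standardise (bottom n k w)) (iterate (binomialTopToRandom q) t (start n))
    ≈ᴰ iterate (binomialTopToRandom q) t (start k)
binomialTopToRandom-lumps d k t q refl rewrite ℕP.m+n∸n≡m d k =
  bottom-lumps d k t λ f → effects-intertwined d k
    (binomialShift q (d ℕ.+ k)) (binomialShift q k) (binomialShift-cong q (d ℕ.+ k))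
    (profile-binomial q (d ℕ.+ k)) (profile-binomial q k) (binomialShift-ℙ^ q d k)
    t _ f (bottom-deck f d k)

theorem6p3 : (n k t : ℕ) → 1 ≤ k → k ≤ n →
    (push (λ w → standardise (bottom n k w)) (iterate topToRandom t (start n))
    ≈ᴰ iterate (lazy (frac (n ∸ k) n) topToRandom) t (start k))
    × ((q₂ : ℚ) → 0ℚ ≤ℚ q₂ → q₂ ≤ℚ 1ℚ →
    push (λ w → standardise (bottom n k w)) (iterate (binomialTopToRandom q₂) t (start n))
    ≈ᴰ iterate (binomialTopToRandom q₂) t (start k))
theorem6p3 n k t 1≤k k≤n =
    topToRandom-lumps (n ∸ k) k t (ℕP.m∸n+n≡m k≤n) 1≤k
  , λ q₂ _ _ → binomialTopToRandom-lumps (n ∸ k) k t q₂ (ℕP.m∸n+n≡m k≤n)
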